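{- Under the partial cost model, for every positive integer $k$ there is a request sequence $\sigma$ on a list of two items with $\mathrm{TS}(\sigma)=\mathrm{MTFO}(\sigma)=\mathrm{MTFE}(\sigma)=10k$ and $\mathrm{OPT}(\sigma)\le 6k$; in particular each of TS, MTFO and MTFE has cost at least $\frac{5}{3}\mathrm{OPT}(\sigma)$ on these sequences. (Hence the bound $\frac53$ of the best of the three algorithms is tight in the partial cost model.)
   Context: Static list update: serving a request to the item at position $i$ costs $i-1$ (partial cost model); the accessed item may be moved closer to the front for free; two adjacent items may be swapped at cost $1$. $A(\sigma)$ is the total cost of algorithm $A$ and $\mathrm{OPT}(\sigma)$ the minimum cost of any offline algorithm from the same initial list. MTFO moves a requested item to the front on the 1st, 3rd, 5th, ... request to that item; MTFE on the 2nd, 4th, 6th, ... request; otherwise they leave it in place. TS (Timestamp): on a request to item $x$, if $x$ has been requested before and some item preceding $x$ has been requested at most once since the previous request to $x$, then $x$ is moved to immediately in front of the frontmost such item; otherwise nothing moves. These three algorithms make no paid exchanges. -}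

module Defs where

open import Data.Bool.Base using (Bool; if_then_else_)
open import Data.Fin.Base using (Fin)
open import Data.Fin.Properties using (_≟_)
open import Data.List.Base using (List; []; _∷_; filter; length; takeWhile)
open import Data.Nat.Base using (ℕ; suc; _+_; _≤_; _≤ᵇ_; _≡ᵇ_; _%_)
open import Data.Product.Base using (_×_)
open import Relation.Binary.Construct.Closure.ReflexiveTransitive using (Star)
open import Relation.Nullary.Decidable using (does; ¬?)
import Data.List.Membership.DecPropositional as DecMembership

private
  variable
    n : ℕ

-- The access cost in the partial cost model: positions count from 1 and an
-- access to position i costs i - 1, the number of items in front.
accessCost : Fin n → List (Fin n) → ℕ
accessCost x []       = 0
accessCost x (y ∷ ys) = if does (x ≟ y) then 0 else suc (accessCost x ys)

-- Exchange x L L′: in L, x is swapped with the item directly in front of it.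
data Exchange (x : Fin n) : List (Fin n) → List (Fin n) → Set where
  here  : ∀ {y zs} → Exchange x (y ∷ x ∷ zs) (x ∷ y ∷ zs)
  there : ∀ {y zs zs′} → Exchange x zs zs′ → Exchange x (y ∷ zs) (y ∷ zs′)

-- Schedule L σ c: an offline way to serve σ starting from the list L with
-- total cost c. Paid exchanges are allowed at any time, and immediately after
-- an access the accessed item may move any distance forward for free.
data Schedule {n} : List (Fin n) → List (Fin n) → ℕ → Set where
  done   : ∀ {L} → Schedule L [] 0
  paid   : ∀ {x L L′ σ c} → Exchange x L L′ →
           Schedule L′ σ c → Schedule L σ (suc c)
  access : ∀ {x L L′ σ c} → Star (Exchange x) L L′ →
           Schedule L′ σ c → Schedule L (x ∷ σ) (accessCost x L + c)

IsOPT : List (Fin n) → List (Fin n) → ℕ → Set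
IsOPT L σ m = Schedule L σ m × (∀ {c} → Schedule L σ c → m ≤ c)

-- An online algorithm without paid exchanges: from the past requests (most
-- recent first), the current list and the current request, the next list.
Algorithm : ℕ → Set
Algorithm n = List (Fin n) → List (Fin n) → Fin n → List (Fin n)

costFrom : List (Fin n) → Algorithm n → List (Fin n) → List (Fin n) → ℕ
costFrom past A L []      = 0
costFrom past A L (x ∷ σ) =
  accessCost x L + costFrom (x ∷ past) A (A past L x) σ

cost : Algorithm n → List (Fin n) → List (Fin n) → ℕ
cost = costFrom []

occurrences : Fin n → List (Fin n) → ℕ
occurrences x ys = length (filter (x ≟_) ys)

remove : Fin n → List (Fin n) → List (Fin n)
remove x = filter (λ y → ¬? (x ≟ y))

moveToFront : Fin n → List (Fin n) → List (Fin n)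
moveToFront x L = x ∷ remove x L

-- Moves x directly in front of the frontmost item that precedes x and
-- satisfies P; the list is unchanged if there is none.
moveBefore : (Fin n → Bool) → Fin n → List (Fin n) → List (Fin n)
moveBefore P x []       = []
moveBefore P x (y ∷ ys) =
  if does (x ≟ y) then y ∷ ys
  else if P y then x ∷ y ∷ remove x ys
  else y ∷ moveBefore P x ys

-- The current request is not part of the past, so it is the 1st, 3rd, 5th, …
-- request to x exactly when the number of past requests to x is even.
MTFO : Algorithm n
MTFO past L x = if occurrences x past % 2 ≡ᵇ 0 then moveToFront x L else L

MTFE : Algorithm n
MTFE past L x = if occurrences x past % 2 ≡ᵇ 1 then moveToFront x L else L

TS : Algorithm n
TS past L x =
  if does (x ∈? past)
  then moveBefore (λ y → occurrences y sincePrevious ≤ᵇ 1) x L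
  else L
  where
  open DecMembership _≟_ using (_∈?_)
  sincePrevious = takeWhile (λ y → ¬? (x ≟ y)) past

{-# OPTIONS --safe #-}

-- With x = 0 and y = 1, one block is (y y x x x y x x)².  Serving it from the
-- list x, y without ever moving anything costs 6, its number of requests to y.
-- Each of the three algorithms pays 10 on it and ends with the list x, y again;
-- MTFO and MTFE interchange their roles between the two halves of a block,
-- since a half contains both items an odd number of times.  OPT itself is
-- given by the usual dynamic programming recursion on the front item.
module Submission where

open import Defs
open import Data.Bool.Base using (true; false; if_then_else_)
open import Data.Fin.Base using (Fin; opposite)
open import Data.Fin.Patterns using (0F; 1F)
open import Data.Fin.Properties using (_≟_)
open import Data.List.Base using (List; []; _∷_; _++_; allFin; concat; replicate; reverse; _ʳ++_)
open import Data.Nat.Base using (ℕ; zero; suc; _+_; _*_; _≤_; _<_; _⊓_; _%_; z≤n; s≤s)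
open import Data.Nat.DivMod using (%-distribˡ-+)
open import Data.Nat.Properties hiding (_≟_)
open import Data.Nat.Tactic.RingSolver using (solve-∀)
open import Data.Product.Base using (_×_; _,_; ∃-syntax)
open import Data.Sum.Base using (inj₁; inj₂)
open import Relation.Binary.Construct.Closure.ReflexiveTransitive using (ε; _◅_)
open import Relation.Binary.PropositionalEquality
  using (_≡_; refl; sym; trans; cong; cong₂; subst; module ≡-Reasoning)
open import Relation.Nullary.Decidable using (does)

private
  variable
    n : ℕ

-- The optimum on two items

listWithFront : Fin 2 → List (Fin 2)
listWithFront f = f ∷ opposite f ∷ []

-- A request to the rear item costs 1 and lets either item be in front afterwards, free of charge.
-- Paid exchanges are left out; `optFrom-minimal` shows that they never help.
optFrom : Fin 2 → List (Fin 2) → ℕ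
optFrom f []      = 0
optFrom f (x ∷ σ) =
  if does (x ≟ f) then optFrom f σ else suc (optFrom f σ ⊓ optFrom x σ)

-- This disposes of paid exchanges: paying 1 to change the front saves at most 1 later. If the
-- fronts differ and `g` is requested, starting from `f` costs 1 and may continue with `g` in front;
-- if `f` is requested, induction applies.
optFrom-lipschitz : ∀ f g σ → optFrom f σ ≤ suc (optFrom g σ)
optFrom-lipschitz f  g  []       = z≤n
optFrom-lipschitz 0F 0F σ        = n≤1+n _
optFrom-lipschitz 1F 1F σ        = n≤1+n _
optFrom-lipschitz 0F 1F (0F ∷ σ) =
  m≤n⇒m≤1+n (⊓-glb (optFrom-lipschitz 0F 1F σ) (n≤1+n _))
optFrom-lipschitz 0F 1F (1F ∷ σ) = s≤s (m⊓n≤n (optFrom 0F σ) _)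
optFrom-lipschitz 1F 0F (0F ∷ σ) = s≤s (m⊓n≤n (optFrom 1F σ) _)
optFrom-lipschitz 1F 0F (1F ∷ σ) =
  m≤n⇒m≤1+n (⊓-glb (optFrom-lipschitz 1F 0F σ) (n≤1+n _))

optFrom-attained : ∀ f σ → Schedule (listWithFront f) σ (optFrom f σ)
optFrom-attained f  []       = done
optFrom-attained 0F (0F ∷ σ) = access ε (optFrom-attained 0F σ)
optFrom-attained 1F (1F ∷ σ) = access ε (optFrom-attained 1F σ)
optFrom-attained 0F (1F ∷ σ) with ⊓-sel (optFrom 0F σ) (optFrom 1F σ)
... | inj₁ eq rewrite eq = access ε (optFrom-attained 0F σ)
... | inj₂ eq rewrite eq = access (here ◅ ε) (optFrom-attained 1F σ)
optFrom-attained 1F (0F ∷ σ) with ⊓-sel (optFrom 1F σ) (optFrom 0F σ)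
... | inj₁ eq rewrite eq = access ε (optFrom-attained 1F σ)
... | inj₂ eq rewrite eq = access (here ◅ ε) (optFrom-attained 0F σ)

optFrom-minimal : ∀ f {σ c} → Schedule (listWithFront f) σ c → optFrom f σ ≤ c
optFrom-minimal f  done = z≤n
optFrom-minimal 0F {σ} (paid here s) =
  ≤-trans (optFrom-lipschitz 0F 1F σ) (s≤s (optFrom-minimal 1F s))
optFrom-minimal 1F {σ} (paid here s) =
  ≤-trans (optFrom-lipschitz 1F 0F σ) (s≤s (optFrom-minimal 0F s))
optFrom-minimal 0F (paid (there (there ())) s)
optFrom-minimal 1F (paid (there (there ())) s)
optFrom-minimal 0F (access {0F} ε s) = optFrom-minimal 0F s
optFrom-minimal 0F (access {1F} ε s) =
  s≤s (≤-trans (m⊓n≤m _ _) (optFrom-minimal 0F s))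
optFrom-minimal 1F (access {0F} ε s) =
  s≤s (≤-trans (m⊓n≤m _ _) (optFrom-minimal 1F s))
optFrom-minimal 1F (access {1F} ε s) = optFrom-minimal 1F s
-- The free move forces the request to be to the rear item; once in front, that item cannot be
-- exchanged forward again.
optFrom-minimal 0F {_ ∷ σ} (access (here ◅ ε) s) =
  s≤s (≤-trans (m⊓n≤n (optFrom 0F σ) _) (optFrom-minimal 1F s))
optFrom-minimal 1F {_ ∷ σ} (access (here ◅ ε) s) =
  s≤s (≤-trans (m⊓n≤n (optFrom 1F σ) _) (optFrom-minimal 0F s))
optFrom-minimal 0F (access (here ◅ there (there ()) ◅ _) s)
optFrom-minimal 1F (access (here ◅ there (there ()) ◅ _) s)
optFrom-minimal 0F (access (there (there ()) ◅ _) s)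
optFrom-minimal 1F (access (there (there ()) ◅ _) s)

optFrom-isOPT : ∀ σ → IsOPT (allFin 2) σ (optFrom 0F σ)
optFrom-isOPT σ = optFrom-attained 0F σ , optFrom-minimal 0F

-- The request sequences

halfBlock block : List (Fin 2)
halfBlock = 1F ∷ 1F ∷ 0F ∷ 0F ∷ 0F ∷ 1F ∷ 0F ∷ 0F ∷ []
block     = halfBlock ++ halfBlock

blocks : ℕ → List (Fin 2)
blocks k = concat (replicate k block)

-- The past is kept most recent first, hence the reversal. As `block` is concrete,
-- `block ʳ++ pastBlocks j` computes to `pastBlocks (suc j)`.
pastBlocks : ℕ → List (Fin 2)
pastBlocks j = concat (replicate j (reverse block))

stayPut : ∀ k → Schedule (allFin 2) (blocks k) (k * 6)
stayPut zero    = done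
stayPut (suc k) =
  stayHalf (stayHalf (stayPut k))
  where
  stayHalf : ∀ {σ c} → Schedule (allFin 2) σ c →
             Schedule (allFin 2) (halfBlock ++ σ) (3 + c)
  stayHalf s =
    access ε (access ε (access ε (access ε
      (access ε (access ε (access ε (access ε s)))))))

opt≤6k : ∀ k → optFrom 0F (blocks k) ≤ 6 * k
opt≤6k k = subst (optFrom 0F (blocks k) ≤_) (*-comm k 6) (optFrom-minimal 0F (stayPut k))

-- Online cost, block by block

listAfter : List (Fin n) → Algorithm n → List (Fin n) → List (Fin n) → List (Fin n)
listAfter past A L []      = L
listAfter past A L (x ∷ σ) = listAfter (x ∷ past) A (A past L x) σ

costFrom-++ : ∀ (A : Algorithm n) past L τ σ →
  costFrom past A L (τ ++ σ) ≡
  costFrom past A L τ + costFrom (τ ʳ++ past) A (listAfter past A L τ) σ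
costFrom-++ A past L []      σ = refl
costFrom-++ A past L (x ∷ τ) σ =
  trans (cong (accessCost x L +_) (costFrom-++ A (x ∷ past) (A past L x) τ σ))
        (sym (+-assoc (accessCost x L) _ _))

PaysTenAndReturns : Algorithm 2 → List (Fin 2) → Set
PaysTenAndReturns A past =
  costFrom past A (allFin 2) block ≡ 10 × listAfter past A (allFin 2) block ≡ allFin 2

cost-blocks : ∀ A → (∀ j → PaysTenAndReturns A (pastBlocks j)) →
              ∀ k → cost A (allFin 2) (blocks k) ≡ 10 * k
cost-blocks A step k = trans (go 0 k) (*-comm k 10)
  where
  open ≡-Reasoning
  -- The list is the same before every block but the past is not, so the induction on `k` has to
  -- hold for any number `j` of blocks already served.
  go : ∀ j k → costFrom (pastBlocks j) A (allFin 2) (blocks k) ≡ k * 10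
  go j zero    = refl
  go j (suc k) with step j
  ... | pays , returns = begin
    costFrom (pastBlocks j) A (allFin 2) (block ++ blocks k)
      ≡⟨ costFrom-++ A (pastBlocks j) (allFin 2) block (blocks k) ⟩
    costFrom (pastBlocks j) A (allFin 2) block
      + costFrom (pastBlocks (suc j)) A (listAfter (pastBlocks j) A (allFin 2) block) (blocks k)
      ≡⟨ cong₂ (λ c L → c + costFrom (pastBlocks (suc j)) A L (blocks k)) pays returns ⟩
    10 + costFrom (pastBlocks (suc j)) A (allFin 2) (blocks k)
      ≡⟨ cong (10 +_) (go (suc j) k) ⟩
    suc k * 10
      ∎

-- TS only looks back to the previous request to the same item, which is inside
-- the last block unless there is none.
TS-block : ∀ j → PaysTenAndReturns TS (pastBlocks j)
TS-block zero    = refl , refl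
TS-block (suc j) = refl , refl

-- Algorithms that depend only on parities

SameParity : List (Fin n) → List (Fin n) → Set
SameParity p q = ∀ x → occurrences x p % 2 ≡ occurrences x q % 2

sameParity-∷ : ∀ (p q : List (Fin n)) y → SameParity p q → SameParity (y ∷ p) (y ∷ q)
sameParity-∷ p q y p~q x with does (x ≟ y)
... | false = p~q x
... | true  = begin
  (1 + occurrences x p) % 2        ≡⟨ %-distribˡ-+ 1 (occurrences x p) 2 ⟩
  (1 + occurrences x p % 2) % 2    ≡⟨ cong (λ r → (1 + r) % 2) (p~q x) ⟩
  (1 + occurrences x q % 2) % 2    ≡⟨ %-distribˡ-+ 1 (occurrences x q) 2 ⟨
  (1 + occurrences x q) % 2        ∎
  where open ≡-Reasoning

ParityBased : Algorithm n → Set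
ParityBased A = ∀ p q → SameParity p q → ∀ L x → A p L x ≡ A q L x

MTFO-parityBased : ParityBased {n} MTFO
MTFO-parityBased p q p~q L x rewrite p~q x = refl

MTFE-parityBased : ParityBased {n} MTFE
MTFE-parityBased p q p~q L x rewrite p~q x = refl

costFrom-sameParity : ∀ {A : Algorithm n} → ParityBased A → ∀ p q → SameParity p q →
                      ∀ L σ → costFrom p A L σ ≡ costFrom q A L σ
costFrom-sameParity based p q p~q L [] = refl
costFrom-sameParity {A = A} based p q p~q L (x ∷ σ) rewrite based p q p~q L x =
  cong (accessCost x L +_)
       (costFrom-sameParity based (x ∷ p) (x ∷ q) (sameParity-∷ p q x p~q) (A q L x) σ)

listAfter-sameParity : ∀ {A : Algorithm n} → ParityBased A → ∀ p q → SameParity p q →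
                       ∀ L σ → listAfter p A L σ ≡ listAfter q A L σ
listAfter-sameParity based p q p~q L [] = refl
listAfter-sameParity {A = A} based p q p~q L (x ∷ σ) rewrite based p q p~q L x =
  listAfter-sameParity based (x ∷ p) (x ∷ q) (sameParity-∷ p q x p~q) (A q L x) σ

-- A block has 10 requests to `0F` and 6 to `1F`, both even, and `_% 2` discards successors in pairs
-- by computation.
pastBlocks-even : ∀ j → SameParity (pastBlocks j) []
pastBlocks-even zero    x  = refl
pastBlocks-even (suc j) 0F = pastBlocks-even j 0F
pastBlocks-even (suc j) 1F = pastBlocks-even j 1F

-- With `j` a variable the counts in `pastBlocks j` do not compute. Having the parities of the empty
-- past, they can be replaced by it, which leaves a single closed computation.
parityBased-block : ∀ A → ParityBased A → PaysTenAndReturns A [] →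
                    ∀ j → PaysTenAndReturns A (pastBlocks j)
parityBased-block A based (pays , returns) j =
  trans (costFrom-sameParity based (pastBlocks j) [] (pastBlocks-even j) (allFin 2) block) pays ,
  trans (listAfter-sameParity based (pastBlocks j) [] (pastBlocks-even j) (allFin 2) block) returns

MTFO-block : ∀ j → PaysTenAndReturns MTFO (pastBlocks j)
MTFO-block = parityBased-block MTFO MTFO-parityBased (refl , refl)

MTFE-block : ∀ j → PaysTenAndReturns MTFE (pastBlocks j)
MTFE-block = parityBased-block MTFE MTFE-parityBased (refl , refl)

-- The ratio 5/3

5opt≤3cost : ∀ {opt c} k → opt ≤ 6 * k → c ≡ 10 * k → 5 * opt ≤ 3 * c
5opt≤3cost {opt} k opt≤ refl = begin
  5 * opt        ≤⟨ *-monoʳ-≤ 5 opt≤ ⟩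
  5 * (6 * k)    ≡⟨ *-assoc 5 6 k ⟨
  30 * k         ≡⟨ *-assoc 3 10 k ⟩
  3 * (10 * k)   ∎
  where open ≤-Reasoning

-- 3p < 5q gives 10q ≥ 6p + 2, so each block gains at least 2, and 1 + qα blocks
-- outweigh the additive constant.
ratio<5/3-exceeded : ∀ p q α {opt} → 3 * p < 5 * q → opt ≤ 6 * suc (q * α) →
                     p * opt + q * α < q * (10 * suc (q * α))
ratio<5/3-exceeded p q α {opt} 3p<5q opt≤ = begin-strict
  p * opt + q * α                ≤⟨ +-monoˡ-≤ (q * α) (*-monoʳ-≤ p opt≤) ⟩
  p * (6 * k) + q * α            <⟨ +-monoʳ-< (p * (6 * k)) (n<1+n (q * α)) ⟩
  p * (6 * k) + k                ≤⟨ +-monoʳ-≤ (p * (6 * k)) (m≤m+n k (k + 0)) ⟩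
  p * (6 * k) + 2 * k            ≡⟨ regroup p k ⟩
  2 * k * suc (3 * p)            ≤⟨ *-monoʳ-≤ (2 * k) 3p<5q ⟩
  2 * k * (5 * q)                ≡⟨ regroup′ q k ⟩
  q * (10 * k)                   ∎
  where
  open ≤-Reasoning
  k = suc (q * α)
  regroup : ∀ p k → p * (6 * k) + 2 * k ≡ 2 * k * suc (3 * p)
  regroup = solve-∀
  regroup′ : ∀ q k → 2 * k * (5 * q) ≡ q * (10 * k)
  regroup′ = solve-∀

theorem4 : (∀ (k : ℕ) → 1 ≤ k →
    ∃[ σ ] ∃[ opt ]
    ( IsOPT (allFin 2) σ opt
    × cost TS   (allFin 2) σ ≡ 10 * k
    × cost MTFO (allFin 2) σ ≡ 10 * k
    × cost MTFE (allFin 2) σ ≡ 10 * k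
    × opt ≤ 6 * k
    × 5 * opt ≤ 3 * cost TS   (allFin 2) σ
    × 5 * opt ≤ 3 * cost MTFO (allFin 2) σ
    × 5 * opt ≤ 3 * cost MTFE (allFin 2) σ ))
    ×
    (∀ (p q α : ℕ) → 3 * p < 5 * q →
    ∃[ σ ] ∃[ opt ]
    ( IsOPT (allFin 2) σ opt
    × p * opt + q * α
    < q * (cost TS (allFin 2) σ ⊓ cost MTFO (allFin 2) σ ⊓ cost MTFE (allFin 2) σ) ))
theorem4 =
  (λ k _ → blocks k , optFrom 0F (blocks k) , optFrom-isOPT (blocks k)
         , ts k , mtfo k , mtfe k , opt≤6k k
         , 5opt≤3cost k (opt≤6k k) (ts k)
         , 5opt≤3cost k (opt≤6k k) (mtfo k)
         , 5opt≤3cost k (opt≤6k k) (mtfe k)) ,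
  -- Tightness with denominators cleared: no ratio `p`/`q` below 5/3 bounds the best of the three,
  -- even up to an additive constant `α`. The hypothesis forces `q` to be positive.
  λ p q α 3p<5q →
    let k = suc (q * α) in
    blocks k , optFrom 0F (blocks k) , optFrom-isOPT (blocks k) ,
    subst (λ c → p * optFrom 0F (blocks k) + q * α < q * c) (sym (best k))
          (ratio<5/3-exceeded p q α 3p<5q (opt≤6k k))
  where
  ts   = cost-blocks TS TS-block
  mtfo = cost-blocks MTFO MTFO-block
  mtfe = cost-blocks MTFE MTFE-block

  best : ∀ k → cost TS (allFin 2) (blocks k) ⊓ cost MTFO (allFin 2) (blocks k)
               ⊓ cost MTFE (allFin 2) (blocks k) ≡ 10 * k
  best k = trans (cong₂ _⊓_ (trans (cong₂ _⊓_ (ts k) (mtfo k)) (⊓-idem _)) (mtfe k))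
                 (⊓-idem _)
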